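{- For every positive integer $n$ and every $S\subseteq[n-1]$, \[ d(S,n)=\sum_{I\subseteq \mathrm{Spike}(S)} p(I,n). \]
   Context: $\mathfrak{S}_n$ is the set of permutations $\sigma=\sigma_1\cdots\sigma_n$ of $[n]=\{1,\ldots,n\}$. $\mathrm{Des}(\sigma)=\{i\in[n-1]:\sigma_i>\sigma_{i+1}\}$; $d(S,n)$ is the number of $\sigma\in\mathfrak{S}_n$ with $\mathrm{Des}(\sigma)=S$. For $S\subseteq[n-1]$: $\mathrm{Peak}(S)=\{i:1<i\le n-1,\ i\in S,\ i-1\notin S\}$, $\mathrm{Valley}(S)=\{i:1<i\le n-1,\ i\notin S,\ i-1\in S\}$, $\mathrm{Spike}(S)=\mathrm{Peak}(S)\cup\mathrm{Valley}(S)$. For $\sigma\in\mathfrak{S}_n$, $\mathrm{Peak}(\sigma)=\mathrm{Peak}(\mathrm{Des}(\sigma))$. For a set $I$, $P(I,n)$ is the set of $\sigma\in\mathfrak{S}_n$ with $\mathrm{Peak}(\sigma)=I$, and $p(I,n)=2^{ -n+|I|+1}|P(I,n)|$. -}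

module Defs where

open import Data.Bool using (Bool; true; false; _∧_; not)
open import Data.Nat using (ℕ; zero; suc; _+_; _*_; _^_)
open import Data.Nat.Properties using (m^n≢0)
open import Data.Fin using (Fin; zero; suc; inject₁; _<?_; _≟_)
open import Data.Fin.Properties using (all?)
open import Data.Fin.Subset using (Subset; _⊆_; ∣_∣; _∪_)
open import Data.Fin.Subset.Properties using (_⊆?_)
open import Data.Vec using (Vec; []; _∷_; lookup; tabulate)
open import Data.Vec.Properties using (≡-dec)
open import Data.List using (List; []; _∷_; _++_; map; concatMap; filter; length; foldr; allFin)
open import Data.Integer using (+_)
open import Data.Rational using (ℚ; 0ℚ; _/_) renaming (_+_ to _+ℚ_)
open import Relation.Nullary.Decidable using (Dec; ⌊_⌋; _→-dec_)
open import Relation.Binary.PropositionalEquality using (_≡_)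
import Data.Bool.Properties as BoolP

allWords : (n k : ℕ) → List (Vec (Fin n) k)
allWords n zero    = [] ∷ []
allWords n (suc k) = concatMap (λ w → map (λ a → a ∷ w) (allFin n)) (allWords n k)

-- σ is a permutation of [n] (written in one-line notation σ₁⋯σₙ, values 0-based)
IsPerm : {n : ℕ} → Vec (Fin n) n → Set
IsPerm {n} σ = (i j : Fin n) → lookup σ i ≡ lookup σ j → i ≡ j

isPerm? : {n : ℕ} (σ : Vec (Fin n) n) → Dec (IsPerm σ)
isPerm? σ = all? (λ i → all? (λ j → (lookup σ i ≟ lookup σ j) →-dec (i ≟ j)))

perms : (n : ℕ) → List (Vec (Fin n) n)
perms n = filter isPerm? (allWords n n)

-- Subsets of [n-1] for n = suc m: Subset m, where Fin index j stands for the element j+1.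
-- Des(σ) = { i ∈ [n-1] : σ_i > σ_{i+1} }
Des : {m : ℕ} → Vec (Fin (suc m)) (suc m) → Subset m
Des σ = tabulate (λ j → ⌊ lookup σ (suc j) <? lookup σ (inject₁ j) ⌋)

d : {m : ℕ} → Subset m → ℕ
d {m} S = length (filter (λ σ → ≡-dec BoolP._≟_ (Des σ) S) (perms (suc m)))

peakAt : {m : ℕ} → Subset m → Fin m → Bool
peakAt S zero = false
peakAt {suc m} S (suc k) = lookup S (suc k) ∧ not (lookup S (inject₁ k))

valleyAt : {m : ℕ} → Subset m → Fin m → Bool
valleyAt S zero = false
valleyAt {suc m} S (suc k) = not (lookup S (suc k)) ∧ lookup S (inject₁ k)

Peak : {m : ℕ} → Subset m → Subset m
Peak S = tabulate (peakAt S)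

Valley : {m : ℕ} → Subset m → Subset m
Valley S = tabulate (valleyAt S)

Spike : {m : ℕ} → Subset m → Subset m
Spike S = Peak S ∪ Valley S

Peakσ : {m : ℕ} → Vec (Fin (suc m)) (suc m) → Subset m
Peakσ σ = Peak (Des σ)

Pcount : {m : ℕ} → Subset m → ℕ
Pcount {m} I = length (filter (λ σ → ≡-dec BoolP._≟_ (Peakσ σ) I) (perms (suc m)))

p : {m : ℕ} → Subset m → ℚ
p {m} I = _/_ (+ (2 ^ (∣ I ∣ + 1) * Pcount I)) (2 ^ suc m) {{m^n≢0 2 (suc m)}}

allSubsets : (m : ℕ) → List (Subset m)
allSubsets zero = [] ∷ []
allSubsets (suc m) = map (true ∷_) (allSubsets m) ++ map (false ∷_) (allSubsets m)

sumℚ : List ℚ → ℚ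
sumℚ = foldr _+ℚ_ 0ℚ

sumSubsetsOf : {m : ℕ} → Subset m → (Subset m → ℚ) → ℚ
sumSubsetsOf {m} X f = sumℚ (map f (filter (λ I → I ⊆? X) (allSubsets m)))

-- Write count T l for the number of injective words with descent set T over an
-- alphabet with l more letters than the word has. Leaving one comparison free
-- splits a word into two independent blocks, so
--   count (T 0 U) l + count (T 1 U) l = count T (|U| + 1 + l) * count U l.
-- The weight w(T, S) = [Peak T ⊆ Spike S] 2^|Peak T| satisfies
--   w(T x U, S 0 V) + w(T x U, S 1 V) = 2 w(T, S) w(U, V),
-- because at most one of the two positions at the joint is a peak and each of
-- them is a spike for exactly one choice of the free bit. Hence
-- Σ_T w(T, S) count T l obeys the same splitting rule as 2^m count S l, and
-- induction on S reduces their equality to S = ∅. There it says that each set of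
-- m + 1 letters carries 2^m words without peaks, which are the hook shapes
-- 1^a 0^b, with (m choose a) words each.
module Submission where

open import Defs
open import Data.Bool using (Bool; true; false; _∧_; _∨_; not; _xor_; if_then_else_)
import Data.Bool.Properties as Bool
open import Data.Nat using (ℕ; zero; suc; _+_; _*_; _^_; _∸_; _!; _<ᵇ_; _≤_; z≤n; s≤s; NonZero)
open import Data.Nat.Properties hiding (_≟_)
open import Algebra.Properties.CommutativeSemigroup +-commutativeSemigroup using (interchange)
open import Data.Nat.Combinatorics using (_C_; nCk≡n!/k![n-k]!; k![n∸k]!∣n!; nCn≡1; nCk+nC[k+1]≡[n+1]C[k+1])
import Data.Nat.DivMod as ℕ
open import Data.Nat.Solver using (module +-*-Solver)
import Data.Integer as ℤ using (_*_)
import Data.Integer.Properties as ℤ using (*-identityʳ; pos-*)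
import Data.Integer.Solver as ℤ using (module +-*-Solver)
import Data.Rational as ℚ using (_+_)
import Data.Rational.Properties as ℚ
open import Data.Rational.Unnormalised using (mkℚᵘ; *≡*)
import Data.Rational.Unnormalised.Properties as ℚᵘ
import Data.Fin as Fin using (_<?_)
open import Data.Fin using (Fin; zero; suc; toℕ; inject₁; punchIn; _≟_)
open import Data.Fin.Properties using (toℕ≤pred[n]; punchIn-injective)
open import Data.Fin.Subset using (Subset; ∣_∣; _∪_)
open import Data.Fin.Subset.Properties using (_⊆?_)
open import Data.List using (List; []; _∷_; _++_; map; concatMap; filter; length; allFin)
open import Data.List.Properties using (map-tabulate)
import Data.Vec as Vec
open Vec using (Vec; []; _∷_; replicate)
open import Data.Vec.Properties using (≡-dec; tabulate∘lookup)
import Data.Vec.Relation.Unary.All as All using (all?; map)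
import Data.Vec.Relation.Unary.All.Properties as All using (map⁻)
open import Data.Vec.Relation.Unary.AllPairs using (allPairs?)
open import Data.Vec.Relation.Unary.Unique.Propositional using (Unique; []; _∷_)
import Data.Vec.Relation.Unary.Unique.Propositional.Properties as Unique
open import Function using (_∘_; id; mk⇔)
open import Relation.Nullary using (Dec; does; ¬?)
open import Relation.Nullary.Decidable using (⌊_⌋; isYes≗does; does-⇔)
open import Relation.Unary using (Decidable)
open import Relation.Binary.PropositionalEquality
  using (_≡_; refl; sym; trans; cong; cong₂; subst; module ≡-Reasoning)
open ≡-Reasoning

private variable
  A B : Set
  a b k m n : ℕ

-- Finite sums

∑ : List A → (A → ℕ) → ℕ
∑ []       f = 0
∑ (x ∷ xs) f = f x + ∑ xs f

∑-cong : (xs : List A) {f g : A → ℕ} → (∀ x → f x ≡ g x) → ∑ xs f ≡ ∑ xs g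
∑-cong []       f≗g = refl
∑-cong (x ∷ xs) f≗g = cong₂ _+_ (f≗g x) (∑-cong xs f≗g)

∑-zero : (xs : List A) → ∑ xs (λ _ → 0) ≡ 0
∑-zero []       = refl
∑-zero (x ∷ xs) = ∑-zero xs

∑-distrib-+ : (xs : List A) (f g : A → ℕ) → ∑ xs (λ x → f x + g x) ≡ ∑ xs f + ∑ xs g
∑-distrib-+ []       f g = refl
∑-distrib-+ (x ∷ xs) f g = trans (cong (f x + g x +_) (∑-distrib-+ xs f g))
  (interchange (f x) (g x) (∑ xs f) (∑ xs g))

*-distribˡ-∑ : (c : ℕ) (xs : List A) (f : A → ℕ) → c * ∑ xs f ≡ ∑ xs (λ x → c * f x)
*-distribˡ-∑ c []       f = *-zeroʳ c
*-distribˡ-∑ c (x ∷ xs) f = trans (*-distribˡ-+ c (f x) (∑ xs f))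
  (cong (c * f x +_) (*-distribˡ-∑ c xs f))

*-distribʳ-∑ : (c : ℕ) (xs : List A) (f : A → ℕ) → ∑ xs f * c ≡ ∑ xs (λ x → f x * c)
*-distribʳ-∑ c xs f = trans (*-comm (∑ xs f) c)
  (trans (*-distribˡ-∑ c xs f) (∑-cong xs (λ x → *-comm c (f x))))

∑-swap : (xs : List A) (ys : List B) (f : A → B → ℕ) →
  ∑ xs (λ x → ∑ ys (f x)) ≡ ∑ ys (λ y → ∑ xs (λ x → f x y))
∑-swap []       ys f = sym (∑-zero ys)
∑-swap (x ∷ xs) ys f = trans (cong (∑ ys (f x) +_) (∑-swap xs ys f))
  (sym (∑-distrib-+ ys (f x) (λ y → ∑ xs (λ x → f x y))))

∑-++ : (xs ys : List A) (f : A → ℕ) → ∑ (xs ++ ys) f ≡ ∑ xs f + ∑ ys f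
∑-++ []       ys f = refl
∑-++ (x ∷ xs) ys f = trans (cong (f x +_) (∑-++ xs ys f)) (sym (+-assoc (f x) _ _))

∑-map : (g : B → A) (ys : List B) (f : A → ℕ) → ∑ (map g ys) f ≡ ∑ ys (f ∘ g)
∑-map g []       f = refl
∑-map g (y ∷ ys) f = cong (f (g y) +_) (∑-map g ys f)

∑-concatMap : (g : B → List A) (ys : List B) (f : A → ℕ) →
  ∑ (concatMap g ys) f ≡ ∑ ys (λ y → ∑ (g y) f)
∑-concatMap g []       f = refl
∑-concatMap g (y ∷ ys) f = trans (∑-++ (g y) (concatMap g ys) f)
  (cong (∑ (g y) f +_) (∑-concatMap g ys f))

𝟙 : Bool → ℕ
𝟙 true  = 1
𝟙 false = 0

𝟙-∧ : ∀ x y → 𝟙 (x ∧ y) ≡ 𝟙 x * 𝟙 y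
𝟙-∧ true  y = sym (+-identityʳ (𝟙 y))
𝟙-∧ false y = refl

∑-filter : {P : A → Set} (P? : Decidable P) (xs : List A) (f : A → ℕ) →
  ∑ (filter P? xs) f ≡ ∑ xs (λ x → 𝟙 (does (P? x)) * f x)
∑-filter P? []       f = refl
∑-filter P? (x ∷ xs) f with does (P? x)
... | true  = cong₂ _+_ (sym (*-identityˡ (f x))) (∑-filter P? xs f)
... | false = ∑-filter P? xs f

∑-allFin-suc : ∀ n (f : Fin (suc n) → ℕ) →
  ∑ (allFin (suc n)) f ≡ f zero + ∑ (allFin n) (f ∘ suc)
∑-allFin-suc n f = cong (f zero +_)
  (trans (cong (λ xs → ∑ xs f) (sym (map-tabulate id suc))) (∑-map suc (allFin n) f))

∑-allFin-last : ∀ n (f : ℕ → ℕ) →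
  ∑ (allFin (suc n)) (f ∘ toℕ) ≡ ∑ (allFin n) (f ∘ toℕ) + f n
∑-allFin-last zero    f = +-comm (f 0) 0
∑-allFin-last (suc n) f = begin
  ∑ (allFin (suc (suc n))) (f ∘ toℕ)
    ≡⟨ ∑-allFin-suc (suc n) (f ∘ toℕ) ⟩
  f 0 + ∑ (allFin (suc n)) (f ∘ suc ∘ toℕ)
    ≡⟨ cong (f 0 +_) (∑-allFin-last n (f ∘ suc)) ⟩
  f 0 + (∑ (allFin n) (f ∘ suc ∘ toℕ) + f (suc n))
    ≡⟨ +-assoc (f 0) _ _ ⟨
  f 0 + ∑ (allFin n) (f ∘ suc ∘ toℕ) + f (suc n)
    ≡⟨ cong (_+ f (suc n)) (∑-allFin-suc n (f ∘ toℕ)) ⟨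
  ∑ (allFin (suc n)) (f ∘ toℕ) + f (suc n) ∎

∑-allSubsets-suc : ∀ m (f : Subset (suc m) → ℕ) →
  ∑ (allSubsets (suc m)) f ≡ ∑ (allSubsets m) (f ∘ (true ∷_)) + ∑ (allSubsets m) (f ∘ (false ∷_))
∑-allSubsets-suc m f = trans (∑-++ (map (true ∷_) (allSubsets m)) _ f)
  (cong₂ _+_ (∑-map (true ∷_) (allSubsets m) f) (∑-map (false ∷_) (allSubsets m) f))

∑-allSubsets-++ : ∀ m n (f : Subset (m + n) → ℕ) →
  ∑ (allSubsets (m + n)) f ≡ ∑ (allSubsets m) (λ T → ∑ (allSubsets n) (λ U → f (T Vec.++ U)))
∑-allSubsets-++ zero    n f = sym (+-identityʳ _)
∑-allSubsets-++ (suc m) n f = begin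
  ∑ (allSubsets (suc (m + n))) f
    ≡⟨ ∑-allSubsets-suc (m + n) f ⟩
  ∑ (allSubsets (m + n)) (f ∘ (true ∷_)) + ∑ (allSubsets (m + n)) (f ∘ (false ∷_))
    ≡⟨ cong₂ _+_ (∑-allSubsets-++ m n (f ∘ (true ∷_))) (∑-allSubsets-++ m n (f ∘ (false ∷_))) ⟩
  ∑ (allSubsets m) (λ T → ∑ (allSubsets n) (λ U → f (true ∷ (T Vec.++ U)))) +
  ∑ (allSubsets m) (λ T → ∑ (allSubsets n) (λ U → f (false ∷ (T Vec.++ U))))
    ≡⟨ ∑-allSubsets-suc m _ ⟨
  ∑ (allSubsets (suc m)) (λ T → ∑ (allSubsets n) (λ U → f (T Vec.++ U))) ∎

≟-complementary : ∀ x → 𝟙 (does (x Bool.≟ false)) + 𝟙 (does (x Bool.≟ true)) ≡ 1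
≟-complementary true  = refl
≟-complementary false = refl

-- Injective words counted by descent set

-- The number of injective words of length m + 1 over an alphabet of
-- m + 1 + l letters with descent set T and first letter j.
countFrom : Subset m → ℕ → ℕ → ℕ
countFrom []              l j = 1
countFrom {suc m} (t ∷ T) l j =
  ∑ (allFin (suc (l + m))) (λ i → 𝟙 (does ((toℕ i <ᵇ j) Bool.≟ t)) * countFrom T l (toℕ i))

-- Every letter in `countFrom` is recorded by its rank among the letters not yet used. The available
-- ranks therefore always form an initial interval, and the letter of rank i after deleting j is
-- smaller than j exactly when i < j.
count : Subset m → ℕ → ℕ
count {m} T l = ∑ (allFin (suc (l + m))) (countFrom T l ∘ toℕ)

-- Seen from a first block with m comparisons, the n + 1 letters of the second block are surplus, so
-- the surplus grows from l to l + n + 1.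
alphabet-size : ∀ l m n → l + (m + suc n) ≡ suc (l + n) + m
alphabet-size = solve 3 (λ l m n → l :+ (m :+ (con 1 :+ n)) := con 1 :+ (l :+ n) :+ m) refl
  where open +-*-Solver

-- Once the comparison between the two blocks is left free, the relative order
-- of the second block is independent of the first one.
countFrom-split : (T : Subset m) (U : Subset n) (l j : ℕ) →
  countFrom (T Vec.++ false ∷ U) l j + countFrom (T Vec.++ true ∷ U) l j ≡
  countFrom T (suc (l + n)) j * count U l
countFrom-split {n = n} [] U l j = begin
  ∑ is (λ i → ⟦ i ⟧ false * f i) + ∑ is (λ i → ⟦ i ⟧ true * f i)
    ≡⟨ ∑-distrib-+ is (λ i → ⟦ i ⟧ false * f i) (λ i → ⟦ i ⟧ true * f i) ⟨
  ∑ is (λ i → ⟦ i ⟧ false * f i + ⟦ i ⟧ true * f i)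
    -- Exactly one of the two outcomes of the comparison occurs, so the indicators add to 1 and j
    -- disappears.
    ≡⟨ ∑-cong is (λ i → trans (sym (*-distribʳ-+ (f i) (⟦ i ⟧ false) (⟦ i ⟧ true)))
         (trans (cong (_* f i) (≟-complementary (toℕ i <ᵇ j))) (*-identityˡ (f i)))) ⟩
  ∑ is f
    ≡⟨ *-identityˡ _ ⟨
  1 * ∑ is f ∎
  where
  is = allFin (suc (l + n))
  f : Fin (suc (l + n)) → ℕ
  f = countFrom U l ∘ toℕ
  ⟦_⟧ : Fin (suc (l + n)) → Bool → ℕ
  ⟦ i ⟧ t = 𝟙 (does ((toℕ i <ᵇ j) Bool.≟ t))
countFrom-split {suc m} {n} (t ∷ T) U l j = begin
  ∑ is (λ i → ⟦ i ⟧ * f false i) + ∑ is (λ i → ⟦ i ⟧ * f true i)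
    ≡⟨ ∑-distrib-+ is (λ i → ⟦ i ⟧ * f false i) (λ i → ⟦ i ⟧ * f true i) ⟨
  ∑ is (λ i → ⟦ i ⟧ * f false i + ⟦ i ⟧ * f true i)
    ≡⟨ ∑-cong is (λ i → trans (sym (*-distribˡ-+ ⟦ i ⟧ (f false i) (f true i)))
         (trans (cong (⟦ i ⟧ *_) (countFrom-split T U l (toℕ i))) (sym (*-assoc ⟦ i ⟧ _ (count U l))))) ⟩
  ∑ is (λ i → ⟦ i ⟧ * countFrom T l′ (toℕ i) * count U l)
    ≡⟨ *-distribʳ-∑ (count U l) is (λ i → ⟦ i ⟧ * countFrom T l′ (toℕ i)) ⟨
  ∑ is (λ i → ⟦ i ⟧ * countFrom T l′ (toℕ i)) * count U l
    ≡⟨ cong (λ N → ∑ (allFin (suc N)) (λ i → 𝟙 (does ((toℕ i <ᵇ j) Bool.≟ t)) * countFrom T l′ (toℕ i)) * count U l)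
         (alphabet-size l m n) ⟩
  countFrom (t ∷ T) l′ j * count U l ∎
  where
  l′ = suc (l + n)
  is = allFin (suc (l + (m + suc n)))
  f : Bool → Fin (suc (l + (m + suc n))) → ℕ
  f b i = countFrom (T Vec.++ b ∷ U) l (toℕ i)
  ⟦_⟧ : Fin (suc (l + (m + suc n))) → ℕ
  ⟦ i ⟧ = 𝟙 (does ((toℕ i <ᵇ j) Bool.≟ t))

count-split : (T : Subset m) (U : Subset n) (l : ℕ) →
  count (T Vec.++ false ∷ U) l + count (T Vec.++ true ∷ U) l ≡ count T (suc (l + n)) * count U l
count-split {m} {n} T U l = begin
  count (T Vec.++ false ∷ U) l + count (T Vec.++ true ∷ U) l
    ≡⟨ ∑-distrib-+ is (countFrom (T Vec.++ false ∷ U) l ∘ toℕ) (countFrom (T Vec.++ true ∷ U) l ∘ toℕ) ⟨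
  ∑ is (λ i → countFrom (T Vec.++ false ∷ U) l (toℕ i) + countFrom (T Vec.++ true ∷ U) l (toℕ i))
    ≡⟨ ∑-cong is (λ i → countFrom-split T U l (toℕ i)) ⟩
  ∑ is (λ i → countFrom T (suc (l + n)) (toℕ i) * count U l)
    ≡⟨ *-distribʳ-∑ (count U l) is (countFrom T (suc (l + n)) ∘ toℕ) ⟨
  ∑ is (λ i → countFrom T (suc (l + n)) (toℕ i)) * count U l
    ≡⟨ cong (λ N → ∑ (allFin (suc N)) (λ i → countFrom T (suc (l + n)) (toℕ i)) * count U l) (alphabet-size l m n) ⟩
  count T (suc (l + n)) * count U l ∎
  where
  is = allFin (suc (l + (m + suc n)))

-- The two vectors have the same entries, but their lengths `suc a + n` and `a + suc n` differ
-- definitionally. A predicate on all lengths carries facts across without casts; the induction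
-- absorbs leading entries into `P`.
replicate-shift : (P : ∀ {k} → Subset k → Set) (x : Bool) (a : ℕ) (U : Subset n) →
  P (replicate (suc a) x Vec.++ U) → P (replicate a x Vec.++ x ∷ U)
replicate-shift P x zero    U h = h
replicate-shift P x (suc a) U h = replicate-shift (P ∘ (x ∷_)) x a U h

++[]-transport : (P : ∀ {k} → Subset k → Set) (T : Subset m) → P T → P (T Vec.++ [])
++[]-transport P []      h = h
++[]-transport P (x ∷ T) h = ++[]-transport (P ∘ (x ∷_)) T h

-- The weight of a pair of subsets

-- The factor contributed by a position i, given t = [i-1 ∈ T], t′ = [i ∈ T], and the same for S.
peakWeight : (t t′ s s′ : Bool) → ℕ
peakWeight t t′ s s′ = if t′ ∧ not t then (if s′ xor s then 2 else 0) else 1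

-- 2 ^ |Peak T| if Peak T ⊆ Spike S and 0 otherwise, where T and S are
-- preceded by t and s.
weightFrom : Bool → Bool → Subset m → Subset m → ℕ
weightFrom t s []       []       = 1
weightFrom t s (t′ ∷ T) (s′ ∷ S) = peakWeight t t′ s s′ * weightFrom t′ s′ T S

-- The preceding true excludes a peak at the first position.
weight : Subset m → Subset m → ℕ
weight = weightFrom true true

-- The free bit of the second set affects only the factors at x and at the first entry of `U`. If
-- neither position is a peak, both choices contribute 1; if one is, one choice contributes 2 and
-- the other 0. The fresh start of `weight U V` gives its first position the factor 1.
weightFrom-join : ∀ t s x (U V : Subset n) →
  weightFrom t s (x ∷ U) (false ∷ V) + weightFrom t s (x ∷ U) (true ∷ V) ≡ 2 * weight U V
weightFrom-join false false false [] [] = refl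
weightFrom-join false false true  [] [] = refl
weightFrom-join false true  false [] [] = refl
weightFrom-join false true  true  [] [] = refl
weightFrom-join true  s     false [] [] = refl
weightFrom-join true  s     true  [] [] = refl
weightFrom-join t s x (u ∷ U) (v ∷ V) = begin
  peakWeight t x s false * (peakWeight x u false v * w) + peakWeight t x s true * (peakWeight x u true v * w)
    ≡⟨ factor (peakWeight t x s false) (peakWeight x u false v) (peakWeight t x s true) (peakWeight x u true v) w ⟩
  (peakWeight t x s false * peakWeight x u false v + peakWeight t x s true * peakWeight x u true v) * w
    ≡⟨ cong (_* w) (table t s x u v) ⟩
  2 * w
    ≡⟨ cong (2 *_) (*-identityˡ w) ⟨
  2 * (1 * w)
    ≡⟨ cong (λ y → 2 * (y * w)) (first u v) ⟨
  2 * (peakWeight true u true v * w) ∎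
  where
  w = weightFrom u v U V
  factor : ∀ e f g h w → e * (f * w) + g * (h * w) ≡ (e * f + g * h) * w
  factor = solve 5 (λ e f g h w → e :* (f :* w) :+ g :* (h :* w) := (e :* f :+ g :* h) :* w) refl
    where open +-*-Solver
  first : ∀ u v → peakWeight true u true v ≡ 1
  first false v = refl
  first true  v = refl
  table : ∀ t s x u v →
    peakWeight t x s false * peakWeight x u false v + peakWeight t x s true * peakWeight x u true v ≡ 2
  table false false false false v     = refl
  table false false false true  false = refl
  table false false false true  true  = refl
  table false false true  false v     = refl
  table false false true  true  v     = refl
  table false true  false false v     = refl
  table false true  false true  false = refl
  table false true  false true  true  = refl
  table false true  true  false v     = refl
  table false true  true  true  v     = refl
  table true  s     false false v     = refl
  table true  s     false true  false = refl
  table true  s     false true  true  = refl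
  table true  s     true  false v     = refl
  table true  s     true  true  v     = refl

weightFrom-split : ∀ t s (T S : Subset m) x (U V : Subset n) →
  weightFrom t s (T Vec.++ x ∷ U) (S Vec.++ false ∷ V) + weightFrom t s (T Vec.++ x ∷ U) (S Vec.++ true ∷ V) ≡
  2 * (weightFrom t s T S * weight U V)
weightFrom-split t s []       []       x U V =
  trans (weightFrom-join t s x U V) (cong (2 *_) (sym (*-identityˡ (weight U V))))
weightFrom-split t s (t′ ∷ T) (s′ ∷ S) x U V = begin
  ω * weightFrom t′ s′ (T Vec.++ x ∷ U) (S Vec.++ false ∷ V) + ω * weightFrom t′ s′ (T Vec.++ x ∷ U) (S Vec.++ true ∷ V)
    ≡⟨ *-distribˡ-+ ω _ _ ⟨
  ω * (weightFrom t′ s′ (T Vec.++ x ∷ U) (S Vec.++ false ∷ V) + weightFrom t′ s′ (T Vec.++ x ∷ U) (S Vec.++ true ∷ V))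
    ≡⟨ cong (ω *_) (weightFrom-split t′ s′ T S x U V) ⟩
  ω * (2 * (weightFrom t′ s′ T S * weight U V))
    ≡⟨ rearrange ω (weightFrom t′ s′ T S) (weight U V) ⟩
  2 * (ω * weightFrom t′ s′ T S * weight U V) ∎
  where
  ω = peakWeight t t′ s s′
  rearrange : ∀ ω w v → ω * (2 * (w * v)) ≡ 2 * (ω * w * v)
  rearrange = solve 3 (λ ω w v → ω :* (con 2 :* (w :* v)) := con 2 :* (ω :* w :* v)) refl
    where open +-*-Solver

-- The splitting rule for weighted counts

weightedCount : Subset m → ℕ → ℕ
weightedCount {m} S l = ∑ (allSubsets m) (λ T → weight T S * count T l)

-- A subset of the joined positions is a triple T, x, U. By `weightFrom-split` the two weights add
-- to a value independent of x, so the sum over x acts on the counts alone; `count-split` then makes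
-- the double sum a product.
weightedCount-split : (S : Subset m) (V : Subset n) (l : ℕ) →
  weightedCount (S Vec.++ false ∷ V) l + weightedCount (S Vec.++ true ∷ V) l ≡
  2 * (weightedCount S (suc (l + n)) * weightedCount V l)
weightedCount-split {m} {n} S V l = begin
  weightedCount (S Vec.++ false ∷ V) l + weightedCount (S Vec.++ true ∷ V) l
    ≡⟨ ∑-distrib-+ (allSubsets (m + suc n)) _ _ ⟨
  ∑ (allSubsets (m + suc n)) (λ T → weight T (S Vec.++ false ∷ V) * count T l + weight T (S Vec.++ true ∷ V) * count T l)
    ≡⟨ ∑-allSubsets-++ m (suc n) _ ⟩
  ∑ (allSubsets m) (λ T → ∑ (allSubsets (suc n)) (λ U → g T U))
    ≡⟨ ∑-cong (allSubsets m) (λ T → ∑-allSubsets-suc n (g T)) ⟩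
  ∑ (allSubsets m) (λ T → ∑ (allSubsets n) (λ U → g T (true ∷ U)) + ∑ (allSubsets n) (λ U → g T (false ∷ U)))
    ≡⟨ ∑-cong (allSubsets m) (λ T → sym (∑-distrib-+ (allSubsets n) _ _)) ⟩
  ∑ (allSubsets m) (λ T → ∑ (allSubsets n) (λ U → g T (true ∷ U) + g T (false ∷ U)))
    ≡⟨ ∑-cong (allSubsets m) (λ T → ∑-cong (allSubsets n) (pointwise T)) ⟩
  ∑ (allSubsets m) (λ T → ∑ (allSubsets n) (λ U → 2 * (weight T S * count T l′) * (weight U V * count U l)))
    ≡⟨ ∑-cong (allSubsets m) (λ T → sym (*-distribˡ-∑ (2 * (weight T S * count T l′)) (allSubsets n) _)) ⟩
  ∑ (allSubsets m) (λ T → 2 * (weight T S * count T l′) * weightedCount V l)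
    ≡⟨ *-distribʳ-∑ (weightedCount V l) (allSubsets m) _ ⟨
  ∑ (allSubsets m) (λ T → 2 * (weight T S * count T l′)) * weightedCount V l
    ≡⟨ cong (_* weightedCount V l) (*-distribˡ-∑ 2 (allSubsets m) _) ⟨
  2 * weightedCount S l′ * weightedCount V l
    ≡⟨ *-assoc 2 (weightedCount S l′) _ ⟩
  2 * (weightedCount S l′ * weightedCount V l) ∎
  where
  l′ = suc (l + n)
  g : Subset m → Subset (suc n) → ℕ
  g T U = weight (T Vec.++ U) (S Vec.++ false ∷ V) * count (T Vec.++ U) l
        + weight (T Vec.++ U) (S Vec.++ true ∷ V) * count (T Vec.++ U) l
  g-split : ∀ T x U → g T (x ∷ U) ≡ 2 * (weight T S * weight U V) * count (T Vec.++ x ∷ U) l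
  g-split T x U = trans (sym (*-distribʳ-+ (count (T Vec.++ x ∷ U) l) (weight (T Vec.++ x ∷ U) (S Vec.++ false ∷ V)) _))
    (cong (_* count (T Vec.++ x ∷ U) l) (weightFrom-split true true T S x U V))
  rearrange : ∀ w v c d → 2 * (w * v) * (c * d) ≡ 2 * (w * c) * (v * d)
  rearrange = solve 4 (λ w v c d → con 2 :* (w :* v) :* (c :* d) := con 2 :* (w :* c) :* (v :* d)) refl
    where open +-*-Solver
  pointwise : ∀ T U → g T (true ∷ U) + g T (false ∷ U) ≡ 2 * (weight T S * count T l′) * (weight U V * count U l)
  pointwise T U = begin
    g T (true ∷ U) + g T (false ∷ U)
      ≡⟨ +-comm (g T (true ∷ U)) _ ⟩
    g T (false ∷ U) + g T (true ∷ U)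
      ≡⟨ cong₂ _+_ (g-split T false U) (g-split T true U) ⟩
    2 * (weight T S * weight U V) * count (T Vec.++ false ∷ U) l + 2 * (weight T S * weight U V) * count (T Vec.++ true ∷ U) l
      ≡⟨ *-distribˡ-+ (2 * (weight T S * weight U V)) _ _ ⟨
    2 * (weight T S * weight U V) * (count (T Vec.++ false ∷ U) l + count (T Vec.++ true ∷ U) l)
      ≡⟨ cong (2 * (weight T S * weight U V) *_) (count-split T U l) ⟩
    2 * (weight T S * weight U V) * (count T l′ * count U l)
      ≡⟨ rearrange (weight T S) (weight U V) (count T l′) (count U l) ⟩
    2 * (weight T S * count T l′) * (weight U V * count U l) ∎

-- Binomial coefficients

choose-! : ∀ x y → ((x + y) C x) * (x ! * y !) ≡ (x + y) !
choose-! x y = begin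
  ((x + y) C x) * (x ! * y !)
    ≡⟨ cong (λ k → ((x + y) C x) * (x ! * k !)) (m+n∸m≡n x y) ⟨
  ((x + y) C x) * (x ! * (x + y ∸ x) !)
    ≡⟨ cong (_* (x ! * (x + y ∸ x) !)) (nCk≡n!/k![n-k]! (m≤m+n x y)) ⟩
  (x + y) ! ℕ./ (x ! * (x + y ∸ x) !) * (x ! * (x + y ∸ x) !)
    ≡⟨ ℕ.m/n*n≡m (k![n∸k]!∣n! (m≤m+n x y)) ⟩
  (x + y) ! ∎
  where instance _ = x !* (x + y ∸ x) !≢0

-- Both sides are the multinomial coefficient: multiplied by x! y! z! they become (x + y + z)!.
trinomial-revision : ∀ x y z →
  ((x + (y + z)) C x) * ((y + z) C y) ≡ ((x + y + z) C (x + y)) * ((x + y) C x)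
trinomial-revision x y z = *-cancelʳ-≡ _ _ (x ! * (y ! * z !)) {{m*n≢0 _ _ {{x !≢0}} {{y !* z !≢0}}}} (begin
  ((x + (y + z)) C x) * ((y + z) C y) * (x ! * (y ! * z !))
    ≡⟨ solve 5 (λ c d f g h → c :* d :* (f :* (g :* h)) := c :* (f :* (d :* (g :* h)))) refl
         ((x + (y + z)) C x) ((y + z) C y) (x !) (y !) (z !) ⟩
  ((x + (y + z)) C x) * (x ! * (((y + z) C y) * (y ! * z !)))
    ≡⟨ cong (λ w → ((x + (y + z)) C x) * (x ! * w)) (choose-! y z) ⟩
  ((x + (y + z)) C x) * (x ! * (y + z) !)
    ≡⟨ choose-! x (y + z) ⟩
  (x + (y + z)) !
    ≡⟨ cong _! (+-assoc x y z) ⟨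
  (x + y + z) !
    ≡⟨ choose-! (x + y) z ⟨
  ((x + y + z) C (x + y)) * ((x + y) ! * z !)
    ≡⟨ cong (λ w → ((x + y + z) C (x + y)) * (w * z !)) (choose-! x y) ⟨
  ((x + y + z) C (x + y)) * (((x + y) C x) * (x ! * y !) * z !)
    ≡⟨ solve 5 (λ c d f g h → c :* d :* (f :* (g :* h)) := c :* (d :* (f :* g) :* h)) refl
         ((x + y + z) C (x + y)) ((x + y) C x) (x !) (y !) (z !) ⟨
  ((x + y + z) C (x + y)) * ((x + y) C x) * (x ! * (y ! * z !)) ∎)
  where open +-*-Solver

hockey-stick : ∀ n a → ∑ (allFin n) (λ i → toℕ i C a) ≡ n C suc a
hockey-stick zero    a = refl
hockey-stick (suc n) a = begin
  ∑ (allFin (suc n)) (λ i → toℕ i C a)      ≡⟨ ∑-allFin-last n (_C a) ⟩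
  ∑ (allFin n) (λ i → toℕ i C a) + n C a    ≡⟨ cong (_+ n C a) (hockey-stick n a) ⟩
  n C suc a + n C a                         ≡⟨ +-comm (n C suc a) _ ⟩
  n C a + n C suc a                         ≡⟨ nCk+nC[k+1]≡[n+1]C[k+1] n a ⟩
  suc n C suc a                             ∎

-- The sum of (a + m) C i over a ≤ i ≤ a + m.
upperSum : ℕ → ℕ → ℕ
upperSum a zero    = 1
upperSum a (suc m) = upperSum (suc a) m + (a + suc m) C a

-- Pascal's rule, applied to each coefficient of row a + m + 2 from index a + 1 on, yields two upper
-- parts of row a + m + 1, starting at a + 1 and at a.
upperSum-pascal : ∀ a m → upperSum (suc a) (suc m) ≡ upperSum (suc a) m + upperSum a (suc m)
upperSum-pascal a zero = cong suc (begin
  suc (a + 1) C suc a                ≡⟨ nCk+nC[k+1]≡[n+1]C[k+1] (a + 1) a ⟨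
  (a + 1) C a + (a + 1) C suc a      ≡⟨ cong (λ n → (a + 1) C a + n C suc a) (+-comm a 1) ⟩
  (a + 1) C a + suc a C suc a        ≡⟨ cong ((a + 1) C a +_) (nCn≡1 (suc a)) ⟩
  (a + 1) C a + 1                    ≡⟨ +-comm _ 1 ⟩
  1 + (a + 1) C a                    ∎)
upperSum-pascal a (suc m) = begin
  upperSum (suc (suc a)) (suc m) + suc N C suc a
    ≡⟨ cong₂ _+_ (upperSum-pascal (suc a) m) (sym (nCk+nC[k+1]≡[n+1]C[k+1] N a)) ⟩
  (upperSum (suc (suc a)) m + upperSum (suc a) (suc m)) + (N C a + N C suc a)
    ≡⟨ solve 4 (λ u v c d → (u :+ v) :+ (c :+ d) := (u :+ d) :+ (v :+ c)) refl
         (upperSum (suc (suc a)) m) (upperSum (suc a) (suc m)) (N C a) (N C suc a) ⟩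
  (upperSum (suc (suc a)) m + N C suc a) + (upperSum (suc a) (suc m) + N C a)
    ≡⟨ cong (λ k → (upperSum (suc (suc a)) m + k C suc a) + (upperSum (suc a) (suc m) + N C a)) (+-suc a (suc m)) ⟩
  upperSum (suc a) (suc m) + upperSum a (suc (suc m)) ∎
  where
  N = a + suc (suc m)
  open +-*-Solver

upperSum-zero : ∀ m → upperSum 0 m ≡ 2 ^ m
upperSum-zero zero          = refl
upperSum-zero (suc zero)    = refl
upperSum-zero (suc (suc m)) = begin
  upperSum 1 (suc m) + 1
    ≡⟨ cong (_+ 1) (upperSum-pascal 0 m) ⟩
  upperSum 1 m + upperSum 0 (suc m) + 1
    -- The 1 is the coefficient at index 0, which completes `upperSum 1 m` to a second
    -- `upperSum 0 (suc m)`.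
    ≡⟨ solve 2 (λ u v → u :+ v :+ con 1 := u :+ con 1 :+ (v :+ con 0)) refl (upperSum 1 m) (upperSum 0 (suc m)) ⟩
  2 * upperSum 0 (suc m)
    ≡⟨ cong (2 *_) (upperSum-zero (suc m)) ⟩
  2 ^ suc (suc m) ∎
  where open +-*-Solver

-- Words without peaks

∑-truncate : ∀ n j (f : ℕ → ℕ) → j ≤ n →
  ∑ (allFin n) (λ i → 𝟙 (does ((toℕ i <ᵇ j) Bool.≟ true)) * f (toℕ i)) ≡ ∑ (allFin j) (f ∘ toℕ)
∑-truncate n       zero    f z≤n       = ∑-zero (allFin n)
∑-truncate (suc n) (suc j) f (s≤s j≤n) = begin
  ∑ (allFin (suc n)) (λ i → 𝟙 (does ((toℕ i <ᵇ suc j) Bool.≟ true)) * f (toℕ i))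
    ≡⟨ ∑-allFin-suc n (λ i → 𝟙 (does ((toℕ i <ᵇ suc j) Bool.≟ true)) * f (toℕ i)) ⟩
  1 * f 0 + ∑ (allFin n) (λ i → 𝟙 (does ((toℕ i <ᵇ j) Bool.≟ true)) * f (suc (toℕ i)))
    ≡⟨ cong₂ _+_ (*-identityˡ (f 0)) (∑-truncate n j (f ∘ suc) j≤n) ⟩
  f 0 + ∑ (allFin j) (f ∘ suc ∘ toℕ)
    ≡⟨ ∑-allFin-suc j (f ∘ toℕ) ⟨
  ∑ (allFin (suc j)) (f ∘ toℕ) ∎

-- The letters after j are any a of the j smaller ones, in decreasing order. The bound on j says
-- that j is a letter of the alphabet.
countFrom-decreasing : ∀ a l j → j ≤ l + a → countFrom (replicate a true) l j ≡ j C a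
countFrom-decreasing zero    l j j≤ = refl
countFrom-decreasing (suc a) l j j≤ = begin
  ∑ is (λ i → 𝟙 (does ((toℕ i <ᵇ j) Bool.≟ true)) * countFrom (replicate a true) l (toℕ i))
    ≡⟨ ∑-cong is (λ i → cong (𝟙 (does ((toℕ i <ᵇ j) Bool.≟ true)) *_)
         (countFrom-decreasing a l (toℕ i) (toℕ≤pred[n] i))) ⟩
  ∑ is (λ i → 𝟙 (does ((toℕ i <ᵇ j) Bool.≟ true)) * (toℕ i C a))
    ≡⟨ ∑-truncate (suc (l + a)) j (_C a) (subst (j ≤_) (+-suc l a) j≤) ⟩
  ∑ (allFin j) (λ i → toℕ i C a)
    ≡⟨ hockey-stick j a ⟩
  j C suc a ∎
  where is = allFin (suc (l + a))

count-decreasing : ∀ a l → count (replicate a true) l ≡ suc (l + a) C suc a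
count-decreasing a l = trans
  (∑-cong (allFin (suc (l + a))) (λ i → countFrom-decreasing a l (toℕ i) (toℕ≤pred[n] i)))
  (hockey-stick (suc (l + a)) a)

-- An injective word with descents exactly at the first a positions is given by
-- its set of letters and the choice of the a letters preceding the minimum.
count-hook : ∀ a b l →
  count (replicate a true Vec.++ replicate b false) l ≡ (suc (l + (a + b)) C suc (a + b)) * ((a + b) C a)
count-hook a zero l =
  ++[]-transport (λ {k} T → count T l ≡ (suc (l + k) C suc k) * (k C a)) (replicate a true) (begin
    count (replicate a true) l           ≡⟨ count-decreasing a l ⟩
    suc (l + a) C suc a                  ≡⟨ *-identityʳ _ ⟨
    (suc (l + a) C suc a) * 1              ≡⟨ cong ((suc (l + a) C suc a) *_) (nCn≡1 a) ⟨
    (suc (l + a) C suc a) * (a C a)        ∎)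
-- Freeing the comparison after the decreasing run gives this hook together with the hook with a + 1
-- descents, which is known because its increasing part is shorter. Pascal's rule splits the total,
-- and the known hook is cancelled.
count-hook a (suc b) l = +-cancelʳ-≡ (K * (N C suc a)) _ _ (begin
  count (replicate a true Vec.++ false ∷ replicate b false) l + K * (N C suc a)
    ≡⟨ cong (count (replicate a true Vec.++ false ∷ replicate b false) l +_) longer ⟨
  count (replicate a true Vec.++ false ∷ replicate b false) l + count (replicate a true Vec.++ true ∷ replicate b false) l
    ≡⟨ count-split (replicate a true) (replicate b false) l ⟩
  count (replicate a true) (suc (l + b)) * count (replicate b false) l
    ≡⟨ cong₂ _*_ (count-decreasing a (suc (l + b))) (trans (count-hook 0 b l) (*-identityʳ _)) ⟩
  (suc (suc (l + b) + a) C suc a) * (suc (l + b) C suc b)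
    ≡⟨ cong₂ (λ x y → (x C suc a) * (y C suc b))
         (solve 3 (λ l b a → con 1 :+ (con 1 :+ (l :+ b) :+ a) := con 1 :+ (a :+ (con 1 :+ (b :+ l)))) refl l b a)
         (cong suc (+-comm l b)) ⟩
  ((suc a + (suc b + l)) C suc a) * ((suc b + l) C suc b)
    ≡⟨ trinomial-revision (suc a) (suc b) l ⟩
  (suc (N + l) C suc N) * (suc N C suc a)
    ≡⟨ cong₂ (λ x y → (suc x C suc N) * y) (+-comm N l) (sym (nCk+nC[k+1]≡[n+1]C[k+1] N a)) ⟩
  K * (N C a + N C suc a)
    ≡⟨ *-distribˡ-+ K _ _ ⟩
  K * (N C a) + K * (N C suc a) ∎)
  where
  open +-*-Solver
  N = a + suc b
  K = suc (l + N) C suc N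
  longer : count (replicate a true Vec.++ true ∷ replicate b false) l ≡ K * (N C suc a)
  longer = replicate-shift (λ {k} T → count T l ≡ (suc (l + k) C suc k) * (k C suc a)) true a (replicate b false)
    (count-hook (suc a) b l)

-- Once an ascent has occurred, the first later descent is a peak. The all-`false` second set has no
-- spikes, so that peak has weight 0 and only the word with no further descents survives.
∑-increasing : ∀ m (g : Subset m → ℕ) →
  ∑ (allSubsets m) (λ T → weightFrom false false T (replicate m false) * g T) ≡ g (replicate m false)
∑-increasing zero    g = trans (+-identityʳ _) (*-identityˡ (g []))
∑-increasing (suc m) g = begin
  ∑ (allSubsets (suc m)) (λ T → weightFrom false false T (replicate (suc m) false) * g T)
    ≡⟨ ∑-allSubsets-suc m (λ T → weightFrom false false T (replicate (suc m) false) * g T) ⟩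
  ∑ (allSubsets m) (λ T → 0) +
  ∑ (allSubsets m) (λ T → 1 * weightFrom false false T (replicate m false) * g (false ∷ T))
    ≡⟨ cong₂ _+_ (∑-zero (allSubsets m))
         (∑-cong (allSubsets m) (λ T → cong (_* g (false ∷ T)) (*-identityˡ (weightFrom false false T (replicate m false))))) ⟩
  ∑ (allSubsets m) (λ T → weightFrom false false T (replicate m false) * g (false ∷ T))
    ≡⟨ ∑-increasing m (g ∘ (false ∷_)) ⟩
  g (replicate (suc m) false) ∎

-- A next bit `true` lengthens the initial run of descents; a next bit `false` leaves a single hook
-- by `∑-increasing`. The surviving hooks have i initial descents for a ≤ i ≤ a + m, and their
-- binomial factors add to `upperSum a m`. The bit s is arbitrary since no peak can follow `true`
-- directly.
∑-hooks : ∀ a m s l →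
  ∑ (allSubsets m) (λ T → weightFrom true s T (replicate m false) * count (replicate a true Vec.++ T) l) ≡
  (suc (l + (a + m)) C suc (a + m)) * upperSum a m
∑-hooks a zero s l = begin
  1 * count (replicate a true Vec.++ []) l + 0
    ≡⟨ trans (+-identityʳ _) (*-identityˡ _) ⟩
  count (replicate a true Vec.++ []) l
    ≡⟨ ++[]-transport (λ {k} T → count T l ≡ suc (l + k) C suc k) (replicate a true) (count-decreasing a l) ⟩
  suc (l + (a + 0)) C suc (a + 0)
    ≡⟨ *-identityʳ _ ⟨
  (suc (l + (a + 0)) C suc (a + 0)) * 1 ∎
∑-hooks a (suc m) s l = begin
  ∑ (allSubsets (suc m)) g
    ≡⟨ ∑-allSubsets-suc m g ⟩
  ∑ (allSubsets m) (λ T → 1 * weightFrom true false T (replicate m false) * count (replicate a true Vec.++ true ∷ T) l) +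
  ∑ (allSubsets m) (λ T → 1 * weightFrom false false T (replicate m false) * count (replicate a true Vec.++ false ∷ T) l)
    ≡⟨ cong₂ _+_
         (∑-cong (allSubsets m) (λ T → cong₂ _*_ (*-identityˡ (weightFrom true false T (replicate m false)))
            (replicate-shift (λ U → count U l ≡ count (true ∷ replicate a true Vec.++ T) l) true a T refl)))
         (∑-cong (allSubsets m) (λ T → cong (_* count (replicate a true Vec.++ false ∷ T) l)
            (*-identityˡ (weightFrom false false T (replicate m false))))) ⟩
  ∑ (allSubsets m) (λ T → weightFrom true false T (replicate m false) * count (replicate (suc a) true Vec.++ T) l) +
  ∑ (allSubsets m) (λ T → weightFrom false false T (replicate m false) * count (replicate a true Vec.++ false ∷ T) l)
    ≡⟨ cong₂ _+_ (∑-hooks (suc a) m false l)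
         (trans (∑-increasing m (λ T → count (replicate a true Vec.++ false ∷ T) l)) (count-hook a (suc m) l)) ⟩
  (suc (l + (suc a + m)) C suc (suc a + m)) * upperSum (suc a) m + K * ((a + suc m) C a)
    ≡⟨ cong (λ k → (suc (l + k) C suc k) * upperSum (suc a) m + K * ((a + suc m) C a)) (+-suc a m) ⟨
  K * upperSum (suc a) m + K * ((a + suc m) C a)
    ≡⟨ *-distribˡ-+ K _ _ ⟨
  K * upperSum a (suc m) ∎
  where
  K = suc (l + (a + suc m)) C suc (a + suc m)
  g : Subset (suc m) → ℕ
  g T = weightFrom true s T (replicate (suc m) false) * count (replicate a true Vec.++ T) l

-- Reduction of every descent set to the empty one

weightedCount-increasing : ∀ m l → weightedCount (replicate m false) l ≡ 2 ^ m * count (replicate m false) l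
weightedCount-increasing m l = begin
  weightedCount (replicate m false) l     ≡⟨ ∑-hooks 0 m true l ⟩
  K * upperSum 0 m                        ≡⟨ cong (K *_) (upperSum-zero m) ⟩
  K * 2 ^ m                               ≡⟨ *-comm K _ ⟩
  2 ^ m * K                               ≡⟨ cong (2 ^ m *_) (trans (count-hook 0 m l) (*-identityʳ K)) ⟨
  2 ^ m * count (replicate m false) l     ∎
  where K = suc (l + m) C suc m

-- The explicit prefix of a entries `false` lets the recursion run on `S` alone: an entry `false`
-- moves into the prefix, and `true` is removed by the splitting rule.
weightedCount-prefixed : ∀ a (S : Subset n) l →
  weightedCount (replicate a false Vec.++ S) l ≡ 2 ^ (a + n) * count (replicate a false Vec.++ S) l
weightedCount-prefixed a [] l =
  ++[]-transport (λ {k} T → weightedCount T l ≡ 2 ^ k * count T l) (replicate a false) (weightedCount-increasing a l)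
weightedCount-prefixed a (false ∷ S) l =
  replicate-shift (λ {k} T → weightedCount T l ≡ 2 ^ k * count T l) false a S (weightedCount-prefixed (suc a) S l)
-- Replacing this `true` by `false` gives a known case, and both factors of the split are known: one
-- has an all-`false` set, the other the shorter `S`. So the two sides have equal sums over the bit,
-- and one summand cancels.
weightedCount-prefixed {suc n} a (true ∷ S) l = +-cancelˡ-≡ (2 ^ (a + suc n) * count (Z Vec.++ false ∷ S) l) _ _ (begin
  2 ^ (a + suc n) * count (Z Vec.++ false ∷ S) l + weightedCount (Z Vec.++ true ∷ S) l
    ≡⟨ cong (_+ weightedCount (Z Vec.++ true ∷ S) l) (replicate-shift (λ {k} T → weightedCount T l ≡ 2 ^ k * count T l)
         false a S (weightedCount-prefixed (suc a) S l)) ⟨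
  weightedCount (Z Vec.++ false ∷ S) l + weightedCount (Z Vec.++ true ∷ S) l
    ≡⟨ weightedCount-split Z S l ⟩
  2 * (weightedCount Z (suc (l + n)) * weightedCount S l)
    ≡⟨ cong (2 *_) (cong₂ _*_ (weightedCount-increasing a (suc (l + n))) (weightedCount-prefixed 0 S l)) ⟩
  2 * (2 ^ a * count Z (suc (l + n)) * (2 ^ n * count S l))
    ≡⟨ solve 4 (λ u v c d → con 2 :* (u :* c :* (v :* d)) := u :* (con 2 :* v) :* (c :* d)) refl
         (2 ^ a) (2 ^ n) (count Z (suc (l + n))) (count S l) ⟩
  2 ^ a * 2 ^ suc n * (count Z (suc (l + n)) * count S l)
    ≡⟨ cong₂ _*_ (^-distribˡ-+-* 2 a (suc n)) (count-split Z S l) ⟨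
  2 ^ (a + suc n) * (count (Z Vec.++ false ∷ S) l + count (Z Vec.++ true ∷ S) l)
    ≡⟨ *-distribˡ-+ (2 ^ (a + suc n)) _ _ ⟩
  2 ^ (a + suc n) * count (Z Vec.++ false ∷ S) l + 2 ^ (a + suc n) * count (Z Vec.++ true ∷ S) l ∎)
  where
  open +-*-Solver
  Z = replicate a false

-- Counting permutations by descent set

infix 4 _≟ₛ_
_≟ₛ_ : (T U : Subset m) → Dec (T ≡ U)
_≟ₛ_ = ≡-dec Bool._≟_

unique? : (w : Vec (Fin n) k) → Dec (Unique w)
unique? = allPairs? (λ x y → ¬? (x ≟ y))

∑-allWords-suc : ∀ n k (f : Vec (Fin n) (suc k) → ℕ) →
  ∑ (allWords n (suc k)) f ≡ ∑ (allWords n k) (λ w → ∑ (allFin n) (λ x → f (x ∷ w)))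
∑-allWords-suc n k f = trans
  (∑-concatMap (λ w → map (λ x → x ∷ w) (allFin n)) (allWords n k) f)
  (∑-cong (allWords n k) (λ w → ∑-map (_∷ w) (allFin n) f))

-- `punchIn x` enumerates the letters other than x in increasing order.
∑-punchIn : (x : Fin (suc n)) (f : Fin (suc n) → ℕ) →
  ∑ (allFin (suc n)) (λ y → 𝟙 (does (¬? (x ≟ y))) * f y) ≡ ∑ (allFin n) (f ∘ punchIn x)
∑-punchIn {n} zero f = trans
  (∑-allFin-suc n (λ y → 𝟙 (does (¬? (zero ≟ y))) * f y))
  (∑-cong (allFin n) (λ y → *-identityˡ (f (suc y))))
∑-punchIn {suc n} (suc x) f = begin
  ∑ (allFin (suc (suc n))) (λ y → 𝟙 (does (¬? (suc x ≟ y))) * f y)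
    ≡⟨ ∑-allFin-suc (suc n) (λ y → 𝟙 (does (¬? (suc x ≟ y))) * f y) ⟩
  1 * f zero + ∑ (allFin (suc n)) (λ y → 𝟙 (does (¬? (x ≟ y))) * f (suc y))
    ≡⟨ cong₂ _+_ (*-identityˡ (f zero)) (∑-punchIn x (f ∘ suc)) ⟩
  f zero + ∑ (allFin n) (f ∘ suc ∘ punchIn x)
    ≡⟨ ∑-allFin-suc n (f ∘ punchIn (suc x)) ⟨
  ∑ (allFin (suc n)) (f ∘ punchIn (suc x)) ∎

∑-words-avoiding : ∀ k (x : Fin (suc n)) (f : Vec (Fin (suc n)) k → ℕ) →
  ∑ (allWords (suc n) k) (λ w → 𝟙 (does (All.all? (λ y → ¬? (x ≟ y)) w)) * f w) ≡
  ∑ (allWords n k) (f ∘ Vec.map (punchIn x))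
∑-words-avoiding zero x f = cong (_+ 0) (*-identityˡ (f []))
∑-words-avoiding {n} (suc k) x f = begin
  ∑ (allWords (suc n) (suc k)) (λ w → avoids w * f w)
    ≡⟨ ∑-allWords-suc (suc n) k (λ w → avoids w * f w) ⟩
  ∑ (allWords (suc n) k) (λ w → ∑ (allFin (suc n)) (λ y → avoids (y ∷ w) * f (y ∷ w)))
    ≡⟨ ∑-cong (allWords (suc n) k) (λ w → ∑-cong (allFin (suc n)) (factor w)) ⟩
  ∑ (allWords (suc n) k) (λ w → ∑ (allFin (suc n)) (λ y → avoids w * (𝟙 (does (¬? (x ≟ y))) * f (y ∷ w))))
    ≡⟨ ∑-cong (allWords (suc n) k)
         (λ w → sym (*-distribˡ-∑ (avoids w) (allFin (suc n)) (λ y → 𝟙 (does (¬? (x ≟ y))) * f (y ∷ w)))) ⟩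
  ∑ (allWords (suc n) k) (λ w → avoids w * ∑ (allFin (suc n)) (λ y → 𝟙 (does (¬? (x ≟ y))) * f (y ∷ w)))
    ≡⟨ ∑-cong (allWords (suc n) k) (λ w → cong (avoids w *_) (∑-punchIn x (λ y → f (y ∷ w)))) ⟩
  ∑ (allWords (suc n) k) (λ w → avoids w * ∑ (allFin n) (λ y → f (punchIn x y ∷ w)))
    ≡⟨ ∑-words-avoiding k x (λ w → ∑ (allFin n) (λ y → f (punchIn x y ∷ w))) ⟩
  ∑ (allWords n k) (λ w → ∑ (allFin n) (λ y → f (punchIn x y ∷ Vec.map (punchIn x) w)))
    ≡⟨ ∑-allWords-suc n k (f ∘ Vec.map (punchIn x)) ⟨
  ∑ (allWords n (suc k)) (f ∘ Vec.map (punchIn x)) ∎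
  where
  avoids : Vec (Fin (suc n)) m → ℕ
  avoids w = 𝟙 (does (All.all? (λ y → ¬? (x ≟ y)) w))
  factor : ∀ w y → avoids (y ∷ w) * f (y ∷ w) ≡ avoids w * (𝟙 (does (¬? (x ≟ y))) * f (y ∷ w))
  factor w y = begin
    avoids (y ∷ w) * f (y ∷ w)
      ≡⟨ cong (_* f (y ∷ w)) (𝟙-∧ (does (¬? (x ≟ y))) _) ⟩
    𝟙 (does (¬? (x ≟ y))) * avoids w * f (y ∷ w)
      ≡⟨ cong (_* f (y ∷ w)) (*-comm (𝟙 (does (¬? (x ≟ y)))) (avoids w)) ⟩
    avoids w * 𝟙 (does (¬? (x ≟ y))) * f (y ∷ w)
      ≡⟨ *-assoc (avoids w) _ _ ⟩
    avoids w * (𝟙 (does (¬? (x ≟ y))) * f (y ∷ w)) ∎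

unique-punchIn : (x : Fin (suc n)) (w : Vec (Fin n) k) →
  does (unique? (Vec.map (punchIn x) w)) ≡ does (unique? w)
unique-punchIn x w = does-⇔ (mk⇔ (map⁻ w) (Unique.map⁺ (punchIn-injective x _ _))) (unique? _) (unique? w)
  where
  map⁻ : (w : Vec _ k) → Unique (Vec.map (punchIn x) w) → Unique w
  map⁻ []      _          = []
  map⁻ (y ∷ w) (y∉w ∷ w!) = All.map (_∘ cong (punchIn x)) (All.map⁻ y∉w) ∷ map⁻ w w!

-- After the first letter x, the rest of an injective word is injective and avoids x, hence is the
-- relabelling by `punchIn x` of a unique injective word over one letter fewer.
∑-unique-suc : ∀ n k (f : Vec (Fin (suc n)) (suc k) → ℕ) →
  ∑ (allWords (suc n) (suc k)) (λ w → 𝟙 (does (unique? w)) * f w) ≡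
  ∑ (allFin (suc n)) (λ x → ∑ (allWords n k) (λ w → 𝟙 (does (unique? w)) * f (x ∷ Vec.map (punchIn x) w)))
∑-unique-suc n k f = begin
  ∑ (allWords (suc n) (suc k)) (λ w → u w * f w)
    ≡⟨ ∑-allWords-suc (suc n) k (λ w → u w * f w) ⟩
  ∑ (allWords (suc n) k) (λ w → ∑ (allFin (suc n)) (λ x → u (x ∷ w) * f (x ∷ w)))
    ≡⟨ ∑-swap (allWords (suc n) k) (allFin (suc n)) (λ w x → u (x ∷ w) * f (x ∷ w)) ⟩
  ∑ (allFin (suc n)) (λ x → ∑ (allWords (suc n) k) (λ w → u (x ∷ w) * f (x ∷ w)))
    ≡⟨ ∑-cong (allFin (suc n)) (λ x → ∑-cong (allWords (suc n) k) (factor x)) ⟩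
  ∑ (allFin (suc n)) (λ x → ∑ (allWords (suc n) k) (λ w → avoids x w * (u w * f (x ∷ w))))
    ≡⟨ ∑-cong (allFin (suc n)) (λ x → ∑-words-avoiding k x (λ w → u w * f (x ∷ w))) ⟩
  ∑ (allFin (suc n)) (λ x → ∑ (allWords n k) (λ w → u (Vec.map (punchIn x) w) * f (x ∷ Vec.map (punchIn x) w)))
    ≡⟨ ∑-cong (allFin (suc n)) (λ x → ∑-cong (allWords n k)
         (λ w → cong (λ b → 𝟙 b * f (x ∷ Vec.map (punchIn x) w)) (unique-punchIn x w))) ⟩
  ∑ (allFin (suc n)) (λ x → ∑ (allWords n k) (λ w → u w * f (x ∷ Vec.map (punchIn x) w))) ∎
  where
  u : Vec (Fin a) b → ℕ
  u w = 𝟙 (does (unique? w))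
  avoids : Fin (suc n) → Vec (Fin (suc n)) k → ℕ
  avoids x w = 𝟙 (does (All.all? (λ y → ¬? (x ≟ y)) w))
  factor : ∀ x w → u (x ∷ w) * f (x ∷ w) ≡ avoids x w * (u w * f (x ∷ w))
  factor x w = trans (cong (_* f (x ∷ w)) (𝟙-∧ (does (All.all? (λ y → ¬? (x ≟ y)) w)) _))
    (*-assoc (avoids x w) (u w) _)

-- A form of `Des` that recurses along the word and keeps word length and alphabet size independent,
-- as the removal of letters requires.
descents : Vec (Fin n) (suc k) → Subset k
descents (x ∷ [])    = []
descents (x ∷ y ∷ w) = (toℕ y <ᵇ toℕ x) ∷ descents (y ∷ w)

Des≡descents : (w : Vec (Fin n) (suc k)) →
  Vec.tabulate (λ j → ⌊ Vec.lookup w (suc j) Fin.<? Vec.lookup w (inject₁ j) ⌋) ≡ descents w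
Des≡descents (x ∷ [])    = refl
Des≡descents (x ∷ y ∷ w) = cong₂ _∷_ (isYes≗does (y Fin.<? x)) (Des≡descents (y ∷ w))

punchIn-<ᵇ : (x : Fin (suc n)) (y z : Fin n) →
  (toℕ (punchIn x y) <ᵇ toℕ (punchIn x z)) ≡ (toℕ y <ᵇ toℕ z)
punchIn-<ᵇ zero    y       z       = refl
punchIn-<ᵇ (suc x) zero    zero    = refl
punchIn-<ᵇ (suc x) zero    (suc z) = refl
punchIn-<ᵇ (suc x) (suc y) zero    = refl
punchIn-<ᵇ (suc x) (suc y) (suc z) = punchIn-<ᵇ x y z

-- Ranks below x are kept and all others are raised by one, so no letter changes sides.
punchIn-<ᵇ-pivot : (x : Fin (suc n)) (y : Fin n) → (toℕ (punchIn x y) <ᵇ toℕ x) ≡ (toℕ y <ᵇ toℕ x)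
punchIn-<ᵇ-pivot zero    y       = refl
punchIn-<ᵇ-pivot (suc x) zero    = refl
punchIn-<ᵇ-pivot (suc x) (suc y) = punchIn-<ᵇ-pivot x y

descents-punchIn : (x : Fin (suc n)) (w : Vec (Fin n) (suc k)) →
  descents (Vec.map (punchIn x) w) ≡ descents w
descents-punchIn x (y ∷ [])    = refl
descents-punchIn x (y ∷ z ∷ w) = cong₂ _∷_ (punchIn-<ᵇ x z y) (descents-punchIn x (z ∷ w))

-- Removing the letters one by one reproduces the recursion of `countFrom`, since relabelling
-- preserves every comparison. The surplus is 0 because a permutation uses all letters.
∑-unique-descents : (S : Subset m) (x : Fin (suc m)) →
  ∑ (allWords m m) (λ w → 𝟙 (does (unique? w)) * 𝟙 (does (descents (x ∷ Vec.map (punchIn x) w) ≟ₛ S))) ≡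
  countFrom S 0 (toℕ x)
∑-unique-descents [] x = refl
∑-unique-descents {suc m} (s ∷ S) x = begin
  ∑ (allWords (suc m) (suc m)) (λ w → 𝟙 (does (unique? w)) * f (x ∷ Vec.map (punchIn x) w))
    ≡⟨ ∑-unique-suc m m (λ w → f (x ∷ Vec.map (punchIn x) w)) ⟩
  ∑ (allFin (suc m)) (λ y → ∑ (allWords m m) (λ w → 𝟙 (does (unique? w)) * f (x ∷ Vec.map (punchIn x) (y ∷ Vec.map (punchIn y) w))))
    ≡⟨ ∑-cong (allFin (suc m)) (λ y → ∑-cong (allWords m m) (factor y)) ⟩
  ∑ (allFin (suc m)) (λ y → ∑ (allWords m m) (λ w → c y * (𝟙 (does (unique? w)) * g (y ∷ Vec.map (punchIn y) w))))
    ≡⟨ ∑-cong (allFin (suc m)) (λ y → sym (*-distribˡ-∑ (c y) (allWords m m) _)) ⟩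
  ∑ (allFin (suc m)) (λ y → c y * ∑ (allWords m m) (λ w → 𝟙 (does (unique? w)) * g (y ∷ Vec.map (punchIn y) w)))
    ≡⟨ ∑-cong (allFin (suc m)) (λ y → cong (c y *_) (∑-unique-descents S y)) ⟩
  countFrom (s ∷ S) 0 (toℕ x) ∎
  where
  f : Vec (Fin (suc (suc m))) (suc (suc m)) → ℕ
  f w = 𝟙 (does (descents w ≟ₛ s ∷ S))
  g : Vec (Fin (suc m)) (suc m) → ℕ
  g w = 𝟙 (does (descents w ≟ₛ S))
  c : Fin (suc m) → ℕ
  c y = 𝟙 (does ((toℕ y <ᵇ toℕ x) Bool.≟ s))
  split : ∀ y w → f (x ∷ Vec.map (punchIn x) (y ∷ w)) ≡ c y * g (y ∷ w)
  split y w = begin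
    𝟙 (does ((toℕ (punchIn x y) <ᵇ toℕ x) ∷ descents (Vec.map (punchIn x) (y ∷ w)) ≟ₛ s ∷ S))
      ≡⟨ cong₂ (λ b T → 𝟙 (does (b ∷ T ≟ₛ s ∷ S))) (punchIn-<ᵇ-pivot x y) (descents-punchIn x (y ∷ w)) ⟩
    𝟙 (does ((toℕ y <ᵇ toℕ x) ∷ descents (y ∷ w) ≟ₛ s ∷ S))
      ≡⟨ 𝟙-∧ (does ((toℕ y <ᵇ toℕ x) Bool.≟ s)) _ ⟩
    c y * g (y ∷ w) ∎
  factor : ∀ y w → 𝟙 (does (unique? w)) * f (x ∷ Vec.map (punchIn x) (y ∷ Vec.map (punchIn y) w)) ≡
    c y * (𝟙 (does (unique? w)) * g (y ∷ Vec.map (punchIn y) w))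
  factor y w = trans (cong (𝟙 (does (unique? w)) *_) (split y (Vec.map (punchIn y) w)))
    (solve 3 (λ u v z → u :* (v :* z) := v :* (u :* z)) refl (𝟙 (does (unique? w))) (c y) (g (y ∷ Vec.map (punchIn y) w)))
    where open +-*-Solver

length-filter : {P : A → Set} (P? : Decidable P) (xs : List A) →
  length (filter P? xs) ≡ ∑ xs (𝟙 ∘ does ∘ P?)
length-filter P? []       = refl
length-filter P? (x ∷ xs) with does (P? x)
... | true  = cong suc (length-filter P? xs)
... | false = length-filter P? xs

isPerm≡unique : (σ : Vec (Fin n) n) → does (isPerm? σ) ≡ does (unique? σ)
isPerm≡unique σ = does-⇔
  (mk⇔ (λ inj → subst Unique (tabulate∘lookup σ) (Unique.tabulate⁺ (inj _ _))) Unique.lookup-injective)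
  (isPerm? σ) (unique? σ)

d≡count : (S : Subset m) → d S ≡ count S 0
d≡count {m} S = begin
  length (filter (λ σ → Des σ ≟ₛ S) (perms (suc m)))
    ≡⟨ length-filter (λ σ → Des σ ≟ₛ S) (perms (suc m)) ⟩
  ∑ (perms (suc m)) (λ σ → 𝟙 (does (Des σ ≟ₛ S)))
    ≡⟨ ∑-filter isPerm? (allWords (suc m) (suc m)) (λ σ → 𝟙 (does (Des σ ≟ₛ S))) ⟩
  ∑ (allWords (suc m) (suc m)) (λ σ → 𝟙 (does (isPerm? σ)) * 𝟙 (does (Des σ ≟ₛ S)))
    ≡⟨ ∑-cong (allWords (suc m) (suc m)) (λ σ → cong₂ (λ b T → 𝟙 b * 𝟙 (does (T ≟ₛ S)))
         (isPerm≡unique σ) (Des≡descents σ)) ⟩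
  ∑ (allWords (suc m) (suc m)) (λ σ → 𝟙 (does (unique? σ)) * 𝟙 (does (descents σ ≟ₛ S)))
    ≡⟨ ∑-unique-suc m m (λ σ → 𝟙 (does (descents σ ≟ₛ S))) ⟩
  ∑ (allFin (suc m)) (λ x → ∑ (allWords m m)
    (λ w → 𝟙 (does (unique? w)) * 𝟙 (does (descents (x ∷ Vec.map (punchIn x) w) ≟ₛ S))))
    ≡⟨ ∑-cong (allFin (suc m)) (∑-unique-descents S) ⟩
  count S 0 ∎

-- Summation over the peak set

∑-≟ₛ : (T : Subset m) (g : Subset m → ℕ) → ∑ (allSubsets m) (λ U → g U * 𝟙 (does (T ≟ₛ U))) ≡ g T
∑-≟ₛ []          g = trans (+-identityʳ _) (*-identityʳ (g []))
∑-≟ₛ {suc m} (true ∷ T) g = begin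
  ∑ (allSubsets (suc m)) (λ U → g U * 𝟙 (does (true ∷ T ≟ₛ U)))
    ≡⟨ ∑-allSubsets-suc m (λ U → g U * 𝟙 (does (true ∷ T ≟ₛ U))) ⟩
  ∑ (allSubsets m) (λ U → g (true ∷ U) * 𝟙 (does (T ≟ₛ U))) + ∑ (allSubsets m) (λ U → g (false ∷ U) * 0)
    ≡⟨ cong₂ _+_ (∑-≟ₛ T (g ∘ (true ∷_)))
         (trans (∑-cong (allSubsets m) (λ U → *-zeroʳ (g (false ∷ U)))) (∑-zero (allSubsets m))) ⟩
  g (true ∷ T) + 0
    ≡⟨ +-identityʳ _ ⟩
  g (true ∷ T) ∎
∑-≟ₛ {suc m} (false ∷ T) g = begin
  ∑ (allSubsets (suc m)) (λ U → g U * 𝟙 (does (false ∷ T ≟ₛ U)))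
    ≡⟨ ∑-allSubsets-suc m (λ U → g U * 𝟙 (does (false ∷ T ≟ₛ U))) ⟩
  ∑ (allSubsets m) (λ U → g (true ∷ U) * 0) + ∑ (allSubsets m) (λ U → g (false ∷ U) * 𝟙 (does (T ≟ₛ U)))
    ≡⟨ cong₂ _+_ (trans (∑-cong (allSubsets m) (λ U → *-zeroʳ (g (true ∷ U)))) (∑-zero (allSubsets m)))
         (∑-≟ₛ T (g ∘ (false ∷_))) ⟩
  g (false ∷ T) ∎

-- Grouping the entries of `xs` by their value under `f`; this serves to pass from peak sets to
-- permutations and from there to descent sets.
∑-fibres : (xs : List A) (f : A → Subset m) (g : Subset m → ℕ) →
  ∑ (allSubsets m) (λ T → g T * length (filter (λ x → f x ≟ₛ T) xs)) ≡ ∑ xs (g ∘ f)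
∑-fibres {m = m} xs f g = begin
  ∑ (allSubsets m) (λ T → g T * length (filter (λ x → f x ≟ₛ T) xs))
    ≡⟨ ∑-cong (allSubsets m) (λ T → trans (cong (g T *_) (length-filter (λ x → f x ≟ₛ T) xs))
         (*-distribˡ-∑ (g T) xs (λ x → 𝟙 (does (f x ≟ₛ T))))) ⟩
  ∑ (allSubsets m) (λ T → ∑ xs (λ x → g T * 𝟙 (does (f x ≟ₛ T))))
    ≡⟨ ∑-swap (allSubsets m) xs (λ T x → g T * 𝟙 (does (f x ≟ₛ T))) ⟩
  ∑ xs (λ x → ∑ (allSubsets m) (λ T → g T * 𝟙 (does (f x ≟ₛ T))))
    ≡⟨ ∑-cong xs (λ x → ∑-≟ₛ (f x) g) ⟩
  ∑ xs (g ∘ f) ∎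

peaksAfter : Bool → Subset m → Subset m
peaksAfter t []       = []
peaksAfter t (t′ ∷ T) = (t′ ∧ not t) ∷ peaksAfter t′ T

-- A position is a spike exactly when membership changes there, hence the `xor`.
spikesAfter : Bool → Subset m → Subset m
spikesAfter s []       = []
spikesAfter s (s′ ∷ S) = (s′ xor s) ∷ spikesAfter s′ S

Peak-∷ : ∀ t (T : Subset m) → Peak (t ∷ T) ≡ false ∷ peaksAfter t T
Peak-∷ t T = cong (false ∷_) (tail t T)
  where
  tail : ∀ t (T : Subset k) → Vec.tabulate (λ j → peakAt (t ∷ T) (suc j)) ≡ peaksAfter t T
  tail t []       = refl
  tail t (t′ ∷ T) = cong (_ ∷_) (tail t′ T)

Spike-∷ : ∀ s (S : Subset m) → Spike (s ∷ S) ≡ false ∷ spikesAfter s S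
Spike-∷ s S = cong (false ∷_) (tail s S)
  where
  peak∨valley : ∀ s s′ → (s′ ∧ not s) ∨ (not s′ ∧ s) ≡ s′ xor s
  peak∨valley s true  = Bool.∨-identityʳ (not s)
  peak∨valley s false = refl
  tail : ∀ s (S : Subset k) →
    Vec.tabulate (λ j → peakAt (s ∷ S) (suc j)) ∪ Vec.tabulate (λ j → valleyAt (s ∷ S) (suc j)) ≡ spikesAfter s S
  tail s []       = refl
  tail s (s′ ∷ S) = cong₂ _∷_ (peak∨valley s s′) (tail s′ S)

-- Both the inclusion test and the power of two are products over positions, and their factors
-- combine to `peakWeight`.
weightFrom-⊆ : ∀ t s (T S : Subset m) →
  𝟙 (does (peaksAfter t T ⊆? spikesAfter s S)) * 2 ^ ∣ peaksAfter t T ∣ ≡ weightFrom t s T S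
weightFrom-⊆ t s []       []       = refl
weightFrom-⊆ t s (t′ ∷ T) (s′ ∷ S) = trans
  (step (t′ ∧ not t) (s′ xor s) (peaksAfter t′ T) (spikesAfter s′ S))
  (cong (peakWeight t t′ s s′ *_) (weightFrom-⊆ t′ s′ T S))
  where
  step : ∀ x y (P Q : Subset k) → 𝟙 (does (x ∷ P ⊆? y ∷ Q)) * 2 ^ ∣ x ∷ P ∣ ≡
    (if x then (if y then 2 else 0) else 1) * (𝟙 (does (P ⊆? Q)) * 2 ^ ∣ P ∣)
  step false y     P Q = sym (*-identityˡ _)
  step true  false P Q = refl
  step true  true  P Q = solve 2 (λ u v → u :* (con 2 :* v) := con 2 :* (u :* v)) refl (𝟙 (does (P ⊆? Q))) (2 ^ ∣ P ∣)
    where open +-*-Solver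

weight-⊆ : (T S : Subset m) → 𝟙 (does (Peak T ⊆? Spike S)) * 2 ^ (∣ Peak T ∣ + 1) ≡ 2 * weight T S
weight-⊆ []      []      = refl
weight-⊆ (t ∷ T) (s ∷ S) = begin
  𝟙 (does (Peak (t ∷ T) ⊆? Spike (s ∷ S))) * 2 ^ (∣ Peak (t ∷ T) ∣ + 1)
    ≡⟨ cong₂ (λ P Q → 𝟙 (does (P ⊆? Q)) * 2 ^ (∣ P ∣ + 1)) (Peak-∷ t T) (Spike-∷ s S) ⟩
  i * 2 ^ (∣ P ∣ + 1)
    ≡⟨ cong (λ e → i * 2 ^ e) (+-comm ∣ P ∣ 1) ⟩
  i * (2 * 2 ^ ∣ P ∣)
    ≡⟨ solve 2 (λ u v → u :* (con 2 :* v) := con 2 :* (u :* v)) refl i (2 ^ ∣ P ∣) ⟩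
  2 * (i * 2 ^ ∣ P ∣)
    ≡⟨ cong (2 *_) (weightFrom-⊆ t s T S) ⟩
  2 * weightFrom t s T S
    ≡⟨ cong (2 *_) (trans (cong (_* weightFrom t s T S) (first t)) (*-identityˡ _)) ⟨
  2 * weight (t ∷ T) (s ∷ S) ∎
  where
  open +-*-Solver
  P = peaksAfter t T
  i = 𝟙 (does (P ⊆? spikesAfter s S))
  first : ∀ t → peakWeight true t true s ≡ 1
  first true  = refl
  first false = refl

-- This is the theorem for n = m + 1 with denominators cleared. The sum over I becomes a sum over
-- permutations, weighted by their peaks, and is regrouped by descent set into
-- `2 * weightedCount S 0`; the 2 comes from the + 1 in the exponent.
∑-Pcount : (S : Subset m) →
  ∑ (filter (_⊆? Spike S) (allSubsets m)) (λ I → 2 ^ (∣ I ∣ + 1) * Pcount I) ≡ 2 ^ suc m * d S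
∑-Pcount {m} S = begin
  ∑ (filter (_⊆? Spike S) (allSubsets m)) (λ I → 2 ^ (∣ I ∣ + 1) * Pcount I)
    ≡⟨ ∑-filter (_⊆? Spike S) (allSubsets m) _ ⟩
  ∑ (allSubsets m) (λ I → 𝟙 (does (I ⊆? Spike S)) * (2 ^ (∣ I ∣ + 1) * Pcount I))
    ≡⟨ ∑-cong (allSubsets m) (λ I → sym (*-assoc (𝟙 (does (I ⊆? Spike S))) _ (Pcount I))) ⟩
  ∑ (allSubsets m) (λ I → h I * Pcount I)
    ≡⟨ ∑-fibres (perms (suc m)) Peakσ h ⟩
  ∑ (perms (suc m)) (λ σ → h (Peak (Des σ)))
    ≡⟨ ∑-cong (perms (suc m)) (λ σ → weight-⊆ (Des σ) S) ⟩
  ∑ (perms (suc m)) (λ σ → 2 * weight (Des σ) S)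
    ≡⟨ *-distribˡ-∑ 2 (perms (suc m)) (λ σ → weight (Des σ) S) ⟨
  2 * ∑ (perms (suc m)) (λ σ → weight (Des σ) S)
    ≡⟨ cong (2 *_) (∑-fibres (perms (suc m)) Des (λ T → weight T S)) ⟨
  2 * ∑ (allSubsets m) (λ T → weight T S * d T)
    ≡⟨ cong (2 *_) (∑-cong (allSubsets m) (λ T → cong (weight T S *_) (d≡count T))) ⟩
  2 * weightedCount S 0
    ≡⟨ cong (2 *_) (weightedCount-prefixed 0 S 0) ⟩
  2 * (2 ^ m * count S 0)
    ≡⟨ *-assoc 2 (2 ^ m) _ ⟨
  2 ^ suc m * count S 0
    ≡⟨ cong (2 ^ suc m *_) (d≡count S) ⟨
  2 ^ suc m * d S ∎
  where
  h : Subset m → ℕ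
  h I = 𝟙 (does (I ⊆? Spike S)) * 2 ^ (∣ I ∣ + 1)

-- Rational sums with a common denominator

open import Data.Integer using (+_)
open import Data.Rational using (_/_)

-- As `_/_` reduces fractions, the comparison is made in the unnormalised rationals, where it is an
-- integer identity after cross-multiplication.
/-distrib-+ : ∀ x y k .{{_ : NonZero k}} → (+ x) / k ℚ.+ (+ y) / k ≡ (+ (x + y)) / k
/-distrib-+ x y (suc k) = ℚ.toℚᵘ-injective (ℚᵘ.≃-trans (ℚ.toℚᵘ-homo-+ ((+ x) / suc k) ((+ y) / suc k))
  (ℚᵘ.≃-trans (ℚᵘ.+-cong (ℚ.toℚᵘ-fromℚᵘ (mkℚᵘ (+ x) k)) (ℚ.toℚᵘ-fromℚᵘ (mkℚᵘ (+ y) k)))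
  (ℚᵘ.≃-trans (*≡* (solve 3 (λ u v w → (u :* w :+ v :* w) :* w := (u :+ v) :* (w :* w)) refl (+ x) (+ y) (+ suc k)))
  (ℚᵘ.≃-sym (ℚ.toℚᵘ-fromℚᵘ (mkℚᵘ (+ (x + y)) k))))))
  where open ℤ.+-*-Solver

/-cancelˡ-* : ∀ x k .{{_ : NonZero k}} → (+ (k * x)) / k ≡ (+ x) / 1
/-cancelˡ-* x (suc k) = ℚ.fromℚᵘ-cong {mkℚᵘ (+ (suc k * x)) k} {mkℚᵘ (+ x) 0} (*≡* (begin
  + (suc k * x) ℤ.* + 1    ≡⟨ ℤ.*-identityʳ (+ (suc k * x)) ⟩
  + (suc k * x)            ≡⟨ cong (λ z → + z) (*-comm (suc k) x) ⟩
  + (x * suc k)            ≡⟨ ℤ.pos-* x (suc k) ⟩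
  + x ℤ.* + suc k          ∎))

sumℚ-/ : ∀ k .{{_ : NonZero k}} (xs : List A) (f : A → ℕ) →
  sumℚ (map (λ x → (+ f x) / k) xs) ≡ (+ ∑ xs f) / k
sumℚ-/ k []       f = sym (ℚ.0/n≡0 k)
sumℚ-/ k (x ∷ xs) f = trans (cong ((+ f x) / k ℚ.+_) (sumℚ-/ k xs f)) (/-distrib-+ (f x) (∑ xs f) k)

mainTheorem2 : (m : ℕ) (S : Subset m) →
    (+ d S) / 1 ≡ sumSubsetsOf (Spike S) (λ I → p I)
mainTheorem2 m S = sym (begin
  sumSubsetsOf (Spike S) p
    ≡⟨ sumℚ-/ (2 ^ suc m) {{m^n≢0 2 (suc m)}} (filter (_⊆? Spike S) (allSubsets m)) _ ⟩
  _/_ (+ ∑ (filter (_⊆? Spike S) (allSubsets m)) (λ I → 2 ^ (∣ I ∣ + 1) * Pcount I)) (2 ^ suc m) {{m^n≢0 2 (suc m)}}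
    ≡⟨ cong (λ z → _/_ (+ z) (2 ^ suc m) {{m^n≢0 2 (suc m)}}) (∑-Pcount S) ⟩
  _/_ (+ (2 ^ suc m * d S)) (2 ^ suc m) {{m^n≢0 2 (suc m)}}
    ≡⟨ /-cancelˡ-* (d S) (2 ^ suc m) {{m^n≢0 2 (suc m)}} ⟩
  (+ d S) / 1 ∎)
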